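{- Let $q$ be an odd prime, and suppose $k, y$ are positive integers with \[ (2^{k}-1)(3^{k}-1)=y^{q}. \] Then $q \mid k$. -}

module Defs where

{-# OPTIONS --safe #-}

-- Every m < q divides k, by strong induction on m; it suffices to treat prime powers m = p ^ a.
-- Let v be the p-adic valuation of k.  For odd p the order d < p of 2 modulo p divides k by
-- induction, so lifting the exponent gives 2 ^ k - 1 the valuation c₁ + v with p ^ c₁ ∣ 2 ^ d - 1,
-- and likewise 3 ^ k - 1 the valuation c₂ + v.  Since 6 ^ (p - 1) < p ^ p we have c₁ + c₂ < p,
-- and q divides c₁ + c₂ + 2v ≠ 0, whence q < p + 2v; with p ^ a < q this forces a ≤ v.
-- For p = 3 only 2 ^ k - 1 contributes, for p = 2 only 3 ^ k - 1 (k is even, else q ∣ 1).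
-- Finally the same bound at p = q reads q < q + 2v, so v > 0.
module Submission where

open import Defs
open import Data.Nat using (ℕ; zero; suc; pred; _+_; _*_; _∸_; _^_; _≤_; _<_; z≤n; s≤s; z<s;
  NonZero; >-nonZero; nonTrivial⇒n>1; _≟_; _<?_)
open import Data.Nat.Properties
open import Data.Nat.Divisibility using (_∣_; _∤_; _∣?_; divides; ∣-refl; ∣-trans; ∣⇒≤; _∣0; 1∣_; ∣1⇒≡1;
  ∣m+n∣m⇒∣n; ∣m⇒∣m*n; ∣n⇒∣m*n; m∣m*n; n∣m*n; m%n≡0⇒n∣m; *-monoʳ-∣; *-cancelˡ-∣)
open import Data.Nat.DivMod using (_%_; _/_; m%n<n; m≡m%n+[m/n]*n)
open import Data.Nat.Primality using (Prime; prime[2]; prime?; euclidsLemma;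
  prime⇒nonZero; prime⇒nonTrivial; prime⇒irreducible)
open import Data.Nat.Primality.Factorisation using (factorise)
open import Data.Nat.Induction using (<-rec)
open import Data.Nat.Tactic.RingSolver using (solve-∀)
open import Data.Fin using (Fin; toℕ; fromℕ<; punchOut) renaming (zero to 0F)
import Data.Fin.Properties as Fin
open import Data.List using ([]; _∷_)
open import Data.List.Relation.Unary.All using (_∷_)
open import Data.Nat.ListAction using (product)
open import Data.Product using (∃; ∃₂; _×_; _,_)
open import Data.Sum using (_⊎_; inj₁; inj₂; [_,_]; map₂)
open import Relation.Binary.PropositionalEquality using (_≡_; _≢_; refl; sym; trans; cong; cong₂; subst)
open import Relation.Nullary using (¬_; yes; no; contradiction)
open import Relation.Nullary.Decidable using (from-yes)

private variable
  p m n k x a b c v z : ℕ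

-- Primes, divisibility and powers.

prime⇒1< : Prime p → 1 < p
prime⇒1< pp = nonTrivial⇒n>1 _ where instance _ = prime⇒nonTrivial pp

prime∤1 : Prime p → p ∤ 1
prime∤1 pp p∣1 = <⇒≢ (prime⇒1< pp) (sym (∣1⇒≡1 p∣1))

prime-∤-* : Prime p → p ∤ m → p ∤ n → p ∤ m * n
prime-∤-* {m = m} {n} pp p∤m p∤n p∣mn with euclidsLemma m n pp p∣mn
... | inj₁ p∣m = p∤m p∣m
... | inj₂ p∣n = p∤n p∣n

prime-∤-^ : Prime p → p ∤ m → ∀ n → p ∤ m ^ n
prime-∤-^ pp p∤m zero    = prime∤1 pp
prime-∤-^ pp p∤m (suc n) = prime-∤-* pp p∤m (prime-∤-^ pp p∤m n)

∃-prime-divisor : 1 < n → ∃ λ p → Prime p × p ∣ n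
∃-prime-divisor {n} 1<n with factorise n {{>-nonZero (<-trans z<s 1<n)}}
... | record { factors = [] ; isFactorisation = n≡1 } = contradiction (sym n≡1) (<⇒≢ 1<n)
... | record { factors = p ∷ ps ; isFactorisation = n≡p*ps ; factorsPrime = pp ∷ _ } =
  p , pp , divides (product ps) (trans n≡p*ps (*-comm p (product ps)))

n<m^n : 1 < m → ∀ n → n < m ^ n
n<m^n 1<m zero    = z<s
n<m^n {m} 1<m (suc n) = ≤-<-trans (n<m^n 1<m n)
  (^-monoʳ-< m 1<m (n<1+n n))

^-distribʳ-* : ∀ m n o → (m * n) ^ o ≡ m ^ o * n ^ o
^-distribʳ-* m n zero    = refl
^-distribʳ-* m n (suc o) = trans (cong (m * n *_) (^-distribʳ-* m n o)) (rearrange m n (m ^ o) (n ^ o))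
  where
  rearrange : ∀ a b c d → a * b * (c * d) ≡ a * c * (b * d)
  rearrange = solve-∀

-- Valuations at a prime.

-- A relation rather than a function, so that 0 needs no default value: at a prime `p`, a
-- factorisation of 0 has cofactor 0, which `p` divides, so 0 has no valuation.
record Valuation (p n a : ℕ) : Set where
  constructor valuation
  field
    cofactor      : ℕ
    factorisation : n ≡ cofactor * p ^ a
    p∤cofactor    : p ∤ cofactor

∤⇒valuation : p ∤ n → Valuation p n 0
∤⇒valuation {n = n} p∤n = valuation n (sym (*-identityʳ n)) p∤n

valuation⇒^∣ : Valuation p n a → p ^ a ∣ n
valuation⇒^∣ (valuation u n≡ _) = divides u n≡

valuation-prime-power : Prime p → ∀ a → Valuation p (p ^ a) a
valuation-prime-power {p} pp a = valuation 1 (sym (*-identityˡ (p ^ a))) (prime∤1 pp)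

valuation-* : Prime p → Valuation p m a → Valuation p n b → Valuation p (m * n) (a + b)
valuation-* {p} {a = a} {b = b} pp (valuation u refl p∤u) (valuation w refl p∤w) =
  valuation (u * w)
    (trans (rearrange u (p ^ a) w (p ^ b)) (cong (u * w *_) (sym (^-distribˡ-+-* p a b))))
    (prime-∤-* pp p∤u p∤w)
  where
  rearrange : ∀ u x w y → u * x * (w * y) ≡ u * w * (x * y)
  rearrange = solve-∀

valuation-^ : Prime p → Valuation p m a → ∀ n → Valuation p (m ^ n) (n * a)
valuation-^ pp val zero    = ∤⇒valuation (prime∤1 pp)
valuation-^ pp val (suc n) = valuation-* pp val (valuation-^ pp val n)

-- Common factors `p` cancel until one exponent is 0; if the other were still positive, `p` would
-- divide a cofactor.
valuation-unique : Prime p → Valuation p n a → Valuation p n b → a ≡ b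
valuation-unique {p} pp (valuation u refl p∤u) (valuation w eq p∤w) = go _ _ eq
  where
  instance _ = prime⇒nonZero pp

  swap : ∀ u p x → u * (p * x) ≡ p * (u * x)
  swap = solve-∀

  absurd : ∀ u w b → p ∤ u → u * 1 ≢ w * p ^ suc b
  absurd u w b p∤u eq = p∤u (subst (p ∣_) (trans (sym eq) (*-identityʳ u)) (∣n⇒∣m*n w (m∣m*n (p ^ b))))

  go : ∀ a b → u * p ^ a ≡ w * p ^ b → a ≡ b
  go zero    zero    _  = refl
  go zero    (suc b) eq = contradiction eq (absurd u w b p∤u)
  go (suc a) zero    eq = contradiction (sym eq) (absurd w u a p∤w)
  go (suc a) (suc b) eq = cong suc (go a b
    (*-cancelˡ-≡ _ _ p (trans (sym (swap u p (p ^ a))) (trans eq (swap w p (p ^ b))))))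

∃-valuation : Prime p → ∀ n → 0 < n → ∃ (Valuation p n)
∃-valuation {p} pp = <-rec (λ n → 0 < n → ∃ (Valuation p n)) step
  where
  instance _ = prime⇒nonZero pp

  step : ∀ n → (∀ {m} → m < n → 0 < m → ∃ (Valuation p m)) → 0 < n → ∃ (Valuation p n)
  step n rec 0<n with p ∣? n
  ... | no  p∤n = 0 , ∤⇒valuation p∤n
  ... | yes (divides zero refl) = contradiction 0<n λ ()
  ... | yes (divides m@(suc _) refl) with rec (m<m*n m p (prime⇒1< pp)) z<s
  ...   | a , valuation u eq p∤u = suc a , valuation u
            (trans (cong (_* p) eq) (trans (*-assoc u (p ^ a) p) (cong (u *_) (*-comm (p ^ a) p)))) p∤u

-- Lifting the exponent.

-- The binomial expansion to third order; t is n (n - 1) / 2, specified without subtraction.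
power-expansion : ∀ z n → ∃₂ λ t w →
  suc z ^ n ≡ suc (z * (n + z * (t + z * w))) × 2 * t + n ≡ n * n
power-expansion z zero = 0 , 0 , eq z , refl
  where
  eq : ∀ z → 1 ≡ suc (z * (0 + z * (0 + z * 0)))
  eq = solve-∀
power-expansion z (suc n) with power-expansion z n
... | t , w , pow≡ , t≡ = t + n , t + w + z * w ,
    trans (cong (suc z *_) pow≡) (expand z n t w) ,
    trans (double t n) (trans (cong (λ s → s + suc (2 * n)) t≡) (square n))
  where
  expand : ∀ z n t w → suc z * suc (z * (n + z * (t + z * w))) ≡
    suc (z * (suc n + z * (t + n + z * (t + w + z * w))))
  expand = solve-∀

  double : ∀ t n → 2 * (t + n) + suc n ≡ 2 * t + n + suc (2 * n)
  double = solve-∀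

  square : ∀ n → n * n + suc (2 * n) ≡ suc n * suc n
  square = solve-∀

valuation⇒∣ : Valuation p n (suc a) → p ∣ n
valuation⇒∣ {p} {a = a} (valuation u refl _) = ∣n⇒∣m*n u (m∣m*n (p ^ a))

∣⇒∤suc : Prime p → p ∣ n → p ∤ suc n
∣⇒∤suc {p} {n} pp p∣n p∣1+n = prime∤1 pp (∣m+n∣m⇒∣n (subst (p ∣_) (+-comm 1 n) p∣1+n) p∣n)

-- The expansion splits `suc z ^ n - 1` into `z` and a factor congruent to `n` modulo `p`, because
-- `p` divides `z`. Writing powers as successors avoids truncated subtraction.
valuation-pow∸1-∤ : Prime p → p ∤ n → Valuation p z (suc c) →
  ∃ λ z′ → suc z ^ n ≡ suc z′ × Valuation p z′ (suc c)
valuation-pow∸1-∤ {p} {n} {z} {c} pp p∤n val with power-expansion z n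
... | t , w , pow≡ , _ = z * (n + z * (t + z * w)) , pow≡ ,
  subst (Valuation p _) (+-identityʳ (suc c)) (valuation-* pp val (∤⇒valuation p∤cofactor))
  where
  p∤cofactor : p ∤ n + z * (t + z * w)
  p∤cofactor p∣sum = p∤n (∣m+n∣m⇒∣n (subst (p ∣_) (+-comm n _) p∣sum)
    (∣m⇒∣m*n (t + z * w) (valuation⇒∣ val)))

-- For p = 2 the hypothesis 4 ∣ z is needed: 3 ^ 2 - 1 = 8 gains two factors of 2 over 3 - 1.
valuation-pow∸1-prime : Prime p → p ∤ 2 ⊎ 1 ≤ c → Valuation p z (suc c) →
  ∃ λ z′ → suc z ^ p ≡ suc z′ × Valuation p z′ (suc (suc c))
valuation-pow∸1-prime {p} {c} {z} pp cond val with power-expansion z p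
... | t , w , pow≡ , t≡ = z * (p + z * (t + z * w)) , pow≡ ,
  subst (Valuation p _) (+-comm (suc c) 1) (valuation-* pp val cofactor-valuation)
  where
  -- The cofactor becomes `p * (1 + s)` with `p ∣ s`, so it contains exactly one factor `p`.
  lift : (∃ λ s → p ∣ s × z * (t + z * w) ≡ s * p) → Valuation p (p + z * (t + z * w)) 1
  lift (s , p∣s , eq) = valuation (suc s)
    (trans (cong (p +_) eq) (cong (suc s *_) (sym (*-identityʳ p)))) (∣⇒∤suc pp p∣s)

  -- Here `2 * t + p ≡ p * p`, so an odd `p` divides `t`; then both terms of `t + z * w` supply a
  -- factor `p`, and `z` supplies another.
  odd : p ∤ 2 → p ∣ z → ∃ λ s → p ∣ s × z * (t + z * w) ≡ s * p
  odd p∤2 (divides z₁ z≡) with euclidsLemma 2 t pp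
    (∣m+n∣m⇒∣n (subst (p ∣_) (trans (sym t≡) (+-comm (2 * t) p)) (m∣m*n p)) ∣-refl)
  ... | inj₁ p∣2 = contradiction p∣2 p∤2
  ... | inj₂ (divides t₁ t≡) = z * (t₁ + z₁ * w) , ∣m⇒∣m*n _ (divides z₁ z≡) ,
    trans (cong₂ (λ t y → z * (t + y * w)) t≡ z≡) (rearrange z t₁ z₁ p w)
    where
    rearrange : ∀ z t₁ z₁ p w → z * (t₁ * p + z₁ * p * w) ≡ z * (t₁ + z₁ * w) * p
    rearrange = solve-∀

  square : p * p ∣ z → ∃ λ s → p ∣ s × z * (t + z * w) ≡ s * p
  square (divides z₂ z≡) = z₂ * p * (t + z * w) , ∣m⇒∣m*n _ (n∣m*n z₂) ,
    trans (cong (_* (t + z * w)) z≡) (rearrange z₂ p (t + z * w))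
    where
    rearrange : ∀ z₂ p y → z₂ * (p * p) * y ≡ z₂ * p * y * p
    rearrange = solve-∀

  p²∣z : ∀ {c} → 1 ≤ c → Valuation p z (suc c) → p * p ∣ z
  p²∣z {suc c} _ (valuation u z≡ _) = ∣-trans (divides (p ^ c) (rearrange p (p ^ c))) (divides u z≡)
    where
    rearrange : ∀ p y → p * (p * y) ≡ y * (p * p)
    rearrange = solve-∀

  cofactor-valuation : Valuation p (p + z * (t + z * w)) 1
  cofactor-valuation = lift ([ (λ p∤2 → odd p∤2 (valuation⇒∣ val)) , (λ 1≤c → square (p²∣z 1≤c val)) ] cond)

-- With `n = u * p ^ b`, raising to the power `u` keeps the valuation, and each of the `b` further
-- `p`-th powers adds 1. The condition `1 ≤ c` survives because the valuation only grows.
lifting-the-exponent : Prime p → p ∤ 2 ⊎ 1 ≤ c → Valuation p z (suc c) → Valuation p n b →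
  ∃ λ z′ → suc z ^ n ≡ suc z′ × Valuation p z′ (suc (b + c))
lifting-the-exponent {p} {c} {z} pp cond val (valuation u refl p∤u) = go _
  where
  lift-cond : ∀ b → p ∤ 2 ⊎ 1 ≤ b + c
  lift-cond b = map₂ (λ 1≤c → ≤-trans 1≤c (m≤n+m c b)) cond

  rearrange : ∀ u x p → u * (p * x) ≡ u * x * p
  rearrange = solve-∀

  go : ∀ b → ∃ λ z′ → suc z ^ (u * p ^ b) ≡ suc z′ × Valuation p z′ (suc (b + c))
  go zero rewrite *-identityʳ u = valuation-pow∸1-∤ pp p∤u val
  go (suc b) with go b
  ... | y , pow≡ , val-y with valuation-pow∸1-prime pp (lift-cond b) val-y
  ...   | z′ , pow≡′ , val-z′ = z′ ,
    trans (cong (suc z ^_) (rearrange u (p ^ b) p))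
      (trans (sym (^-*-assoc (suc z) (u * p ^ b) p)) (trans (cong (_^ p) pow≡) pow≡′)) ,
    val-z′

-- Powers congruent to 1 modulo `p`, and the valuation of `x ^ k - 1`.

-- The p powers x ^ 0 , … , x ^ (p - 1) have only p - 1 possible nonzero residues.
∃-order : Prime p → p ∤ x → ∃₂ λ d z → 0 < d × d < p × x ^ d ≡ suc z × p ∣ z
∃-order {p@(suc e)} {x} pp p∤x = collide (Fin.pigeonhole (n<1+n e) residue)
  where
  remainder : ℕ → Fin p
  remainder n = fromℕ< (m%n<n n p)

  0≢remainder : ∀ i → 0F ≢ remainder (x ^ i)
  0≢remainder i eq = prime-∤-^ pp p∤x i
    (m%n≡0⇒n∣m _ p (trans (sym (Fin.toℕ-fromℕ< (m%n<n (x ^ i) p))) (cong toℕ (sym eq))))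

  residue : Fin p → Fin e
  residue i = punchOut (0≢remainder (toℕ i))

  %-equal : ∀ i j → remainder (x ^ i) ≡ remainder (x ^ j) → x ^ i % p ≡ x ^ j % p
  %-equal i j eq = trans (sym (Fin.toℕ-fromℕ< (m%n<n (x ^ i) p)))
    (trans (cong toℕ eq) (Fin.toℕ-fromℕ< (m%n<n (x ^ j) p)))

  %-equal⇒∣ : ∀ y z → y % p ≡ (y + z) % p → p ∣ z
  %-equal⇒∣ y z eq = ∣m+n∣m⇒∣n
    (divides ((y + z) / p) (+-cancelˡ-≡ (y % p) _ _
      (trans (shift (y % p) (y / p * p) z) (trans (cong (_+ z) (sym (m≡m%n+[m/n]*n y p)))
        (trans (m≡m%n+[m/n]*n (y + z) p) (cong (_+ (y + z) / p * p) (sym eq)))))))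
    (n∣m*n (y / p))
    where
    shift : ∀ r s z → r + (s + z) ≡ r + s + z
    shift = solve-∀

  collide : (∃₂ λ i j → toℕ i < toℕ j × residue i ≡ residue j) →
    ∃₂ λ d z → 0 < d × d < p × x ^ d ≡ suc z × p ∣ z
  -- `d` is the gap between two exponents with equal residues: `p` divides `x ^ i * (x ^ d - 1)` but
  -- not `x ^ i`.
  collide (i , j , i<j , eq) = finish (toℕ j ∸ toℕ i) (m<n⇒0<n∸m i<j)
    (≤-<-trans (m∸n≤m (toℕ j) (toℕ i)) (Fin.toℕ<n j)) (m+[n∸m]≡n (<⇒≤ i<j))
    where
    finish : ∀ d → 0 < d → d < p → toℕ i + d ≡ toℕ j →
      ∃₂ λ d z → 0 < d × d < p × x ^ d ≡ suc z × p ∣ z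
    finish d 0<d d<p i+d≡j with x ^ d in xᵈ≡
    ... | zero  = contradiction (subst (p ∣_) (sym xᵈ≡) (p ∣0)) (prime-∤-^ pp p∤x d)
    ... | suc z = d , z , 0<d , d<p , xᵈ≡ , p∣z
      where
      xʲ≡ : x ^ toℕ j ≡ x ^ toℕ i + x ^ toℕ i * z
      xʲ≡ = trans (cong (x ^_) (sym i+d≡j)) (trans (^-distribˡ-+-* x (toℕ i) d)
        (trans (cong (x ^ toℕ i *_) xᵈ≡) (*-suc (x ^ toℕ i) z)))

      p∣z : p ∣ z
      p∣z with euclidsLemma (x ^ toℕ i) z pp (%-equal⇒∣ (x ^ toℕ i) _
        (trans (%-equal (toℕ i) (toℕ j)
          (Fin.punchOut-injective (0≢remainder (toℕ i)) (0≢remainder (toℕ j)) eq)) (cong (_% p) xʲ≡)))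
      ... | inj₁ p∣xⁱ = contradiction p∣xⁱ (prime-∤-^ pp p∤x (toℕ i))
      ... | inj₂ p∣z  = p∣z

-- Write `k = n * d` with `p ∣ x ^ d - 1` and `0 < d < p`. Then `p ∤ d`, so `n` has the valuation
-- `v` of `k`, and lifting from `x ^ d` to its `n`-th power adds `v` to the valuation `c` of
-- `x ^ d - 1`. The size of `x ^ d` bounds `p ^ c`.
valuation-pow∸1 : Prime p → p ∤ 2 → 1 < x → p ∤ x → 0 < k → (∀ d → 0 < d → d < p → d ∣ k) →
  Valuation p k v → ∃₂ λ c z → x ^ k ≡ suc z × Valuation p z (c + v) × 0 < c × p ^ c < x ^ pred p
valuation-pow∸1 {p} {x} {k} {v} pp p∤2 1<x p∤x 0<k small∣k val-k with ∃-order pp p∤x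
... | d , zero , 0<d , _ , xᵈ≡1 , _ = contradiction (sym xᵈ≡1) (<⇒≢ (^-monoʳ-< x 1<x 0<d))
... | d@(suc _) , z@(suc _) , 0<d , d<p , xᵈ≡ , p∣z with small∣k d 0<d d<p
...   | divides zero k≡0 = contradiction (sym k≡0) (<⇒≢ 0<k)
...   | divides n@(suc _) k≡ with ∃-valuation pp z z<s | ∃-valuation pp n z<s
...     | zero  , valuation u z≡ p∤u | _ =
          contradiction (subst (p ∣_) (trans z≡ (*-identityʳ u)) p∣z) p∤u
...     | suc c , val-z | b , val-n with lifting-the-exponent pp (inj₁ p∤2) val-z val-n
...       | z′ , pow≡ , val-z′ = suc c , z′ ,
            trans (cong (x ^_) (trans k≡ (*-comm n d)))
              (trans (sym (^-*-assoc x d n)) (trans (cong (_^ n) xᵈ≡) pow≡)) ,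
            subst (Valuation p z′) (trans (cong (λ e → suc (e + c)) b≡v) (cong suc (+-comm v c))) val-z′ ,
            z<s , pᶜ<
  where
  instance _ = >-nonZero (<-trans z<s 1<x)

  b≡v : b ≡ v
  b≡v = trans (sym (+-identityʳ b)) (valuation-unique pp
    (subst (λ m → Valuation p m (b + 0)) (sym k≡)
      (valuation-* pp val-n (∤⇒valuation λ p∣d → <⇒≱ d<p (∣⇒≤ p∣d))))
    val-k)

  open ≤-Reasoning
  pᶜ< : p ^ suc c < x ^ pred p
  pᶜ< = begin-strict
    p ^ suc c  ≤⟨ ∣⇒≤ (valuation⇒^∣ val-z) ⟩
    z          <⟨ n<1+n z ⟩
    suc z      ≡⟨ xᵈ≡ ⟨
    x ^ d      ≤⟨ ^-monoʳ-≤ x (<⇒≤pred d<p) ⟩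
    x ^ pred p ∎

-- Upper bounds on `q` from the perfect power.

-- The valuation of `y ^ q` is `q` times that of `y`.
perfect-power⇒∣valuation : ∀ q y → Prime p → 0 < y → m * n ≡ y ^ q →
  Valuation p m a → Valuation p n b → q ∣ a + b
perfect-power⇒∣valuation {p} q y pp 0<y mn≡ val-m val-n with ∃-valuation pp y 0<y
... | e , val-y = subst (q ∣_) (valuation-unique pp (valuation-^ pp val-y q)
  (subst (λ n → Valuation p n _) mn≡ (valuation-* pp val-m val-n))) (m∣m*n e)

product≡ : ∀ k y q {z₁ z₂} → (2 ^ k ∸ 1) * (3 ^ k ∸ 1) ≡ y ^ q →
  2 ^ k ≡ suc z₁ → 3 ^ k ≡ suc z₂ → z₁ * z₂ ≡ y ^ q
product≡ k y q eq 2ᵏ≡ 3ᵏ≡ = trans (sym (cong₂ (λ s t → (s ∸ 1) * (t ∸ 1)) 2ᵏ≡ 3ᵏ≡)) eq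

pow-suc-pred : ∀ p k .{{_ : NonZero p}} → p ^ k ≡ suc (p ^ k ∸ 1)
pow-suc-pred p k = sym (suc-pred (p ^ k) {{m^n≢0 p k}})

-- Serves for `2 ^ k - 1` at 2 and `3 ^ k - 1` at 3, which thus contribute nothing to the valuation
-- of the product.
∤-pow∸1 : Prime p → 0 < k → p ∤ p ^ k ∸ 1
∤-pow∸1 {p} {k@(suc i)} pp 0<k p∣ = ∣⇒∤suc pp p∣ (subst (p ∣_) (pow-suc-pred p k) (m∣m*n (p ^ i)))
  where instance _ = prime⇒nonZero pp

prime[3] : Prime 3
prime[3] = from-yes (prime? 3)

prime∤prime : ∀ {q} → Prime p → Prime q → p ≢ q → p ∤ q
prime∤prime pp pq p≢q p∣q with prime⇒irreducible pq p∣q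
... | inj₁ p≡1 = <⇒≢ (prime⇒1< pp) (sym p≡1)
... | inj₂ p≡q = p≢q p≡q

prime≥5 : Prime p → p ∤ 2 → p ≢ 3 → 5 ≤ p
prime≥5 {0} pp _ _ = contradiction (prime⇒1< pp) λ ()
prime≥5 {1} pp _ _ = contradiction (prime⇒1< pp) λ { (s≤s ()) }
prime≥5 {2} _ p∤2 _ = contradiction ∣-refl p∤2
prime≥5 {3} _ _ p≢3 = contradiction refl p≢3
prime≥5 {4} pp _ _ with prime⇒irreducible pp (divides {2} 2 refl)
... | inj₁ ()
... | inj₂ ()
prime≥5 {suc (suc (suc (suc (suc _))))} _ _ _ = s≤s (s≤s (s≤s (s≤s (s≤s z≤n))))

-- For `p ≥ 6` the left side `6 ^ (p - 1)` is at most `p ^ (p - 1)`; for 5 it is 1296 < 3125. It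
-- fails at 3, where 36 > 27, so that prime is treated apart.
2^*3^<p^p : 5 ≤ p → 2 ^ pred p * 3 ^ pred p < p ^ p
2^*3^<p^p {p} 5≤p rewrite sym (^-distribʳ-* 2 3 (pred p)) with m≤n⇒m<n∨m≡n 5≤p
... | inj₂ refl = from-yes (6 ^ 4 <? 5 ^ 5)
... | inj₁ 6≤p@(s≤s {n = e} _) = ≤-<-trans (^-monoˡ-≤ e 6≤p)
  (^-monoʳ-< p (≤-trans (s≤s (s≤s z≤n)) 5≤p) (n<1+n e))

^-cancelˡ-< : ∀ p a b .{{_ : NonZero p}} → p ^ a < p ^ b → a < b
^-cancelˡ-< p a b pᵃ<pᵇ = ≰⇒> λ b≤a → <⇒≱ pᵃ<pᵇ (^-monoʳ-≤ p b≤a)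

-- Serves twice: for `p < q` it forces powers of `p` into `k`, and for `p = q` it ends the proof.
odd-prime-bound : ∀ {q y} → Prime p → p ∤ 2 → 0 < k → 0 < y →
  (2 ^ k ∸ 1) * (3 ^ k ∸ 1) ≡ y ^ q → (∀ d → 0 < d → d < p → d ∣ k) →
  Valuation p k v → q < p + 2 * v
odd-prime-bound {p} {k} {v} {q} {y} pp p∤2 0<k 0<y eq small∣k val-k
  with valuation-pow∸1 pp p∤2 (s≤s (s≤s z≤n)) p∤2 0<k small∣k val-k
-- Positivity of `c₁` makes the valuation of the product nonzero, so that divisibility by `q` bounds
-- `q`.
... | c₁@(suc _) , z₁ , 2ᵏ≡ , val-z₁ , 0<c₁ , pᶜ¹< with p ≟ 3
...   | yes refl = begin-strict
  q                ≤⟨ ∣⇒≤ (perfect-power⇒∣valuation q y pp 0<y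
                       (product≡ k y q eq 2ᵏ≡ (pow-suc-pred 3 k)) val-z₁ (∤⇒valuation (∤-pow∸1 pp 0<k))) ⟩
  c₁ + v + 0       ≡⟨ +-identityʳ (c₁ + v) ⟩
  -- `c₁ < 3 ^ c₁` and `3 ^ c₁ < 2 ^ 2` give `c₁ < 3`.
  c₁ + v           <⟨ +-monoˡ-< v (<-≤-trans (n<m^n (s≤s (s≤s z≤n)) c₁) (≤-pred pᶜ¹<)) ⟩
  3 + v            ≤⟨ +-monoʳ-≤ 3 (m≤m+n v (v + 0)) ⟩
  3 + 2 * v        ∎
  where open ≤-Reasoning
...   | no p≢3 with valuation-pow∸1 pp p∤2 (s≤s (s≤s z≤n)) (prime∤prime pp prime[3] p≢3) 0<k small∣k val-k
...     | c₂ , z₂ , 3ᵏ≡ , val-z₂ , 0<c₂ , pᶜ²< = begin-strict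
  q                    ≤⟨ ∣⇒≤ (perfect-power⇒∣valuation q y pp 0<y (product≡ k y q eq 2ᵏ≡ 3ᵏ≡) val-z₁ val-z₂) ⟩
  (c₁ + v) + (c₂ + v)  ≡⟨ rearrange c₁ c₂ v ⟩
  (c₁ + c₂) + 2 * v    <⟨ +-monoˡ-< (2 * v) (^-cancelˡ-< p (c₁ + c₂) p (subst (_< p ^ p) (sym (^-distribˡ-+-* p c₁ c₂))
                           (<-trans (*-mono-< pᶜ¹< pᶜ²<) (2^*3^<p^p (prime≥5 pp p∤2 p≢3))))) ⟩
  p + 2 * v            ∎
  where
  open ≤-Reasoning
  instance _ = prime⇒nonZero pp
  rearrange : ∀ c₁ c₂ v → (c₁ + v) + (c₂ + v) ≡ (c₁ + c₂) + 2 * v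
  rearrange = solve-∀

two-bound : ∀ {q y} → Prime q → 0 < k → 0 < y → (2 ^ k ∸ 1) * (3 ^ k ∸ 1) ≡ y ^ q →
  ∃ λ b → Valuation 2 k (suc b) × q ≤ b + 3
two-bound {k} {q} {y} pq 0<k 0<y eq with 2 ∣? k
-- For odd `k` the number `3 ^ k - 1` has the same valuation at 2 as `3 - 1`, namely 1, and `q`
-- would divide 1.
... | no 2∤k with valuation-pow∸1-∤ prime[2] 2∤k (valuation-prime-power prime[2] 1)
...   | z , 3ᵏ≡ , val-z = contradiction
  (perfect-power⇒∣valuation q y prime[2] 0<y (product≡ k y q eq (pow-suc-pred 2 k) 3ᵏ≡)
    (∤⇒valuation (∤-pow∸1 prime[2] 0<k)) val-z)
  (prime∤1 pq)
two-bound {k} {q} {y} pq 0<k 0<y eq | yes (divides zero k≡0) = contradiction (sym k≡0) (<⇒≢ 0<k)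
two-bound {k} {q} {y} pq 0<k 0<y eq | yes (divides n@(suc _) k≡) with ∃-valuation prime[2] n z<s
... | b , val-n with lifting-the-exponent prime[2] (inj₂ (s≤s z≤n)) (valuation-prime-power prime[2] 3) val-n
-- Lifting starts from `9 = 3 ^ 2`, since `9 - 1 = 2 ^ 3` satisfies the extra condition at 2. With
-- `k = 2 * n` the valuations are `b + 1` for `k` and `b + 3` for `9 ^ n - 1`.
...   | z , 9ⁿ≡ , val-z = b ,
  subst (λ k → Valuation 2 k (suc b)) (trans (*-comm 2 n) (sym k≡))
    (valuation-* prime[2] (valuation-prime-power prime[2] 1) val-n) ,
  subst (q ≤_) (sym (+-suc b 2)) (∣⇒≤ (perfect-power⇒∣valuation q y prime[2] 0<y
    (product≡ k y q eq (pow-suc-pred 2 k)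
      (trans (cong (3 ^_) (trans k≡ (*-comm n 2))) (trans (sym (^-*-assoc 3 2 n)) 9ⁿ≡)))
    (∤⇒valuation (∤-pow∸1 prime[2] 0<k)) val-z))

-- Divisors of `k` below `q`.

-- Each step adds 2 on the left and at least doubles the right, which is at least 2. Used to refute
-- `v ≤ a` when `p ^ (1 + a) < q < p + 2 * v`.
p+2a≤p^[1+a] : 1 < p → ∀ a → p + 2 * a ≤ p ^ suc a
p+2a≤p^[1+a] {p} 1<p zero    = ≤-reflexive (trans (+-identityʳ p) (sym (*-identityʳ p)))
p+2a≤p^[1+a] {p} 1<p (suc a) = begin
  p + 2 * suc a           ≡⟨ rearrange p a ⟩
  (p + 2 * a) + 2         ≤⟨ +-mono-≤ (p+2a≤p^[1+a] 1<p a) (≤-trans 1<p (≤-trans (m≤m+n p (2 * a)) (p+2a≤p^[1+a] 1<p a))) ⟩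
  p ^ suc a + p ^ suc a   ≡⟨ cong (p ^ suc a +_) (+-identityʳ (p ^ suc a)) ⟨
  2 * p ^ suc a           ≤⟨ *-monoˡ-≤ (p ^ suc a) 1<p ⟩
  p ^ suc (suc a)         ∎
  where
  open ≤-Reasoning
  rearrange : ∀ p a → p + 2 * suc a ≡ (p + 2 * a) + 2
  rearrange = solve-∀

^-monoʳ-∣ : ∀ p a b → a ≤ b → p ^ a ∣ p ^ b
^-monoʳ-∣ p a b a≤b = subst (p ^ a ∣_)
  (trans (sym (^-distribˡ-+-* p a (b ∸ a))) (cong (p ^_) (m+[n∸m]≡n a≤b))) (m∣m*n (p ^ (b ∸ a)))

prime-power-∣ : ∀ {q y} → Prime q → 0 < k → 0 < y → (2 ^ k ∸ 1) * (3 ^ k ∸ 1) ≡ y ^ q →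
  Prime p → ∀ a → p ^ suc a < q → (∀ d → 0 < d → d < p → d ∣ k) → p ^ suc a ∣ k
prime-power-∣ {k} {p} {q} {y} pq 0<k 0<y eq pp a pᵃ<q small∣k with p ≟ 2
... | yes refl with two-bound {k} pq 0<k 0<y eq
...   | b , val-k , q≤b+3 = ∣-trans (^-monoʳ-∣ 2 (suc a) (suc b) a≤b) (valuation⇒^∣ val-k)
  where
  a≤b : suc a ≤ suc b
  -- The two strict inequalities in `a + 1 < 2 ^ (a + 1) < q ≤ b + 3` make up for the offset 3.
  a≤b = ≤-pred (≤-pred (begin
    3 + a              ≤⟨ s≤s (n<m^n (s≤s (s≤s z≤n)) (suc a)) ⟩
    suc (2 ^ suc a)    ≤⟨ pᵃ<q ⟩
    q                  ≤⟨ q≤b+3 ⟩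
    b + 3              ≡⟨ +-comm b 3 ⟩
    3 + b              ∎))
    where open ≤-Reasoning
prime-power-∣ {k} {p} {q} {y} pq 0<k 0<y eq pp a pᵃ<q small∣k | no p≢2 with ∃-valuation pp k 0<k
... | v , val-k = ∣-trans (^-monoʳ-∣ p (suc a) v (≰⇒> a≰v)) (valuation⇒^∣ val-k)
  where
  open ≤-Reasoning
  a≰v : ¬ (v ≤ a)
  a≰v v≤a = <-irrefl refl (begin-strict
    q             <⟨ odd-prime-bound {k = k} {q = q} {y} pp (prime∤prime pp prime[2] p≢2) 0<k 0<y eq small∣k val-k ⟩
    p + 2 * v     ≤⟨ +-monoʳ-≤ p (*-monoʳ-≤ 2 v≤a) ⟩
    p + 2 * a     ≤⟨ p+2a≤p^[1+a] (prime⇒1< pp) a ⟩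
    p ^ suc a     <⟨ pᵃ<q ⟩
    q             ∎)

-- Euclid's lemma moves one factor `p` at a time into `n`; this is Gauss's lemma for the coprime
-- pair `m` and `p ^ a`.
^∣*⇒^∣ : Prime p → p ∤ m → ∀ a n → p ^ a ∣ m * n → p ^ a ∣ n
^∣*⇒^∣ pp p∤m zero    _ _ = 1∣ _
^∣*⇒^∣ {p} {m} pp p∤m (suc a) n pᵃ∣mn with euclidsLemma m n pp (∣-trans (m∣m*n (p ^ a)) pᵃ∣mn)
... | inj₁ p∣m = contradiction p∣m p∤m
... | inj₂ (divides n′ refl) = subst (p ^ suc a ∣_) (*-comm p n′) (*-monoʳ-∣ p
  (^∣*⇒^∣ pp p∤m a n′ (*-cancelˡ-∣ p (subst (p ^ suc a ∣_) (rearrange m n′ p) pᵃ∣mn))))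
  where
  instance _ = prime⇒nonZero pp
  rearrange : ∀ m n p → m * (n * p) ≡ p * (m * n)
  rearrange = solve-∀

below-exponent-∣ : ∀ {q y} → Prime q → 0 < k → 0 < y → (2 ^ k ∸ 1) * (3 ^ k ∸ 1) ≡ y ^ q →
  ∀ m → 0 < m → m < q → m ∣ k
below-exponent-∣ {k} {q} {y} pq 0<k 0<y eq = <-rec (λ m → 0 < m → m < q → m ∣ k) step
  where
  step : ∀ m → (∀ {d} → d < m → 0 < d → d < q → d ∣ k) → 0 < m → m < q → m ∣ k
  step 1 _ _ _ = 1∣ k
  step m@(suc (suc _)) rec 0<m m<q with ∃-prime-divisor {m} (s≤s (s≤s z≤n))
  ... | p , pp , p∣m with ∃-valuation pp m 0<m
  ...   | zero  , valuation u m≡ p∤u = contradiction (subst (p ∣_) (trans m≡ (*-identityʳ u)) p∣m) p∤u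
  ...   | suc a , valuation 0 _ p∤0 = contradiction (p ∣0) p∤0
  ...   | suc a , valuation 1 m≡ _ = subst (_∣ k) (sym m≡pᵃ)
    (prime-power-∣ pq 0<k 0<y eq pp a (subst (_< q) m≡pᵃ m<q)
      λ d 0<d d<p → rec (<-≤-trans d<p (∣⇒≤ p∣m)) 0<d (<-trans d<p (≤-<-trans (∣⇒≤ p∣m) m<q)))
    where
    m≡pᵃ : m ≡ p ^ suc a
    m≡pᵃ = trans m≡ (*-identityˡ (p ^ suc a))
  -- Both `u` and `p ^ suc a` are smaller than `m`, so both divide `k` by induction; being coprime,
  -- their product `m` does too.
  ...   | suc a , valuation u@(suc (suc _)) m≡ p∤u = combine (rec u<m z<s (<-trans u<m m<q))
    where
    instance
      _ = prime⇒nonZero pp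
      _ = m^n≢0 p (suc a)

    pᵃ<m : p ^ suc a < m
    pᵃ<m = subst (p ^ suc a <_) (trans (*-comm (p ^ suc a) u) (sym m≡)) (m<m*n (p ^ suc a) u (s≤s (s≤s z≤n)))

    u<m : u < m
    u<m = subst (u <_) (sym m≡) (m<m*n u (p ^ suc a) (^-monoʳ-< p (prime⇒1< pp) (z<s {a})))

    combine : u ∣ k → m ∣ k
    combine (divides s k≡) = subst (_∣ k) (sym m≡) (subst (u * p ^ suc a ∣_) (sym k≡us)
      (*-monoʳ-∣ u (^∣*⇒^∣ pp p∤u (suc a) s
        (subst (p ^ suc a ∣_) k≡us (rec pᵃ<m (m^n>0 p (suc a)) (<-trans pᵃ<m m<q))))))
      where
      k≡us : k ≡ u * s
      k≡us = trans k≡ (*-comm s u)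

theorem5 : (q k y : ℕ) → Prime q → ¬ (2 ∣ q) → 0 < k → 0 < y →
    (2 ^ k ∸ 1) * (3 ^ k ∸ 1) ≡ y ^ q → q ∣ k
theorem5 q k y pq 2∤q 0<k 0<y eq with ∃-valuation pq k 0<k
... | suc v , val-k = valuation⇒∣ val-k
... | zero  , val-k = contradiction
  (odd-prime-bound {k = k} {q = q} {y} pq (prime∤prime pq prime[2] λ { refl → 2∤q ∣-refl }) 0<k 0<y eq
    (below-exponent-∣ pq 0<k 0<y eq) val-k)
  (<-irrefl (sym (+-identityʳ q)))
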